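{- Let $k\ge1$ be an integer. For every $\alpha<k+1$ there exists an instance of the $k$-robust fault-tolerant facility location problem for which the integrality gap of the LP relaxation given in the context, i.e. the ratio of the minimum cost of an integral solution to the minimum cost of a fractional solution, is at least $\alpha$.
   Context: Instance of the problem: finite sets $\mathcal F$ of facilities (with $|\mathcal F|\ge k+1$) and $\mathcal C$ of clients, opening costs $f_i\ge0$, and metric connection costs $c_{ij}\ge0$. LP relaxation, with scenarios $A$ ranging over all $k$-element subsets of $\mathcal F$: minimize $\sum_{i}f_iy_i+\max_A\sum_j\sum_ic_{ij}x_{A,ij}$ subject to $\sum_ix_{A,ij}\ge1$ for all $A$ and $j$; $x_{A,ij}\le y_i$ for all $i,A,j$; $x_{A,ij}=0$ for all $A$, $i\in A$, $j$; $x_{A,ij},y_i\ge0$. Integral solutions are solutions of this program with all $x_{A,ij},y_i$ integers; they are exactly the feasible solutions of the problem: open a set of facilities, an adversary closes a set $A$ of $k$ facilities, and each client is connected to a remaining open facility, the cost being the opening cost plus the worst-case connection cost. -}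

module Defs where

open import Level using (Level; _⊔_) renaming (suc to lsuc)
open import Algebra.Bundles using (CommutativeRing)
import Algebra.Definitions.RawMonoid as RawMonoidDefinitions
import Algebra.Properties.CommutativeMonoid.Sum as Summation
open import Data.Fin using (Fin)
open import Data.Fin.Subset using (Subset; _∈_; ∣_∣)
open import Data.Integer using (ℤ; +_; -[1+_])
open import Data.Nat as ℕ using (ℕ; suc)
open import Data.Product using (Σ; ∃; _×_; proj₁)
open import Data.Sum using (_⊎_; inj₁; inj₂)
import Function.Metric.Definitions as Metric
open import Function.Metric.Structures using (IsPreMetric)
open import Relation.Binary.Construct.NonStrictToStrict as Strict using ()
open import Relation.Binary.Core using (Rel)
open import Relation.Binary.PropositionalEquality using (_≡_)
open import Relation.Binary.Structures using (IsTotalOrder)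
open import Relation.Nullary using (¬_)

-- The standard library has no type of real numbers, so costs, LP variables
-- and α range over an arbitrary Archimedean ordered field.  The reals and
-- the rationals are both models.
record ArchimedeanOrderedField (c ℓ₁ ℓ₂ : Level) : Set (lsuc (c ⊔ ℓ₁ ⊔ ℓ₂)) where
  infix 4 _≤_ _<_
  field
    commutativeRing : CommutativeRing c ℓ₁

  open CommutativeRing commutativeRing public

  field
    _≤_           : Rel Carrier ℓ₂
    isTotalOrder  : IsTotalOrder _≈_ _≤_
    +-monoˡ-≤     : ∀ z {x y} → x ≤ y → x + z ≤ y + z
    *-nonNegative : ∀ {x y} → 0# ≤ x → 0# ≤ y → 0# ≤ x * y
    0≉1           : ¬ (0# ≈ 1#)
    inverse       : ∀ x → ¬ (x ≈ 0#) → ∃ λ y → x * y ≈ 1#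

  open RawMonoidDefinitions +-rawMonoid using () renaming (_×_ to _×ℕ_)

  fromℕ : ℕ → Carrier
  fromℕ n = n ×ℕ 1#

  field
    archimedean : ∀ x → ∃ λ n → x ≤ fromℕ n

  open Summation +-commutativeMonoid public using (sum)

  _<_ : Rel Carrier (ℓ₁ ⊔ ℓ₂)
  _<_ = Strict._<_ _≈_ _≤_

  fromℤ : ℤ → Carrier
  fromℤ (+ n)    = fromℕ n
  fromℤ -[1+ n ] = - fromℕ (suc n)

  IsInteger : Carrier → Set ℓ₁
  IsInteger x = ∃ λ z → x ≈ fromℤ z

  IsLeast : ∀ {p} → (Carrier → Set p) → Carrier → Set (c ⊔ ℓ₂ ⊔ p)
  IsLeast P v = P v × (∀ w → P w → v ≤ w)

  IsGreatest : ∀ {p} → (Carrier → Set p) → Carrier → Set (c ⊔ ℓ₂ ⊔ p)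
  IsGreatest P v = P v × (∀ w → P w → w ≤ v)

module _ {c ℓ₁ ℓ₂ : Level} (K : ArchimedeanOrderedField c ℓ₁ ℓ₂) where
  open ArchimedeanOrderedField K

  -- Distances live on the disjoint union of facilities and clients.  Distinct
  -- points may be at distance 0 (a client located at a facility), so dist is
  -- a pseudometric.
  record Instance (k : ℕ) : Set (c ⊔ ℓ₁ ⊔ ℓ₂) where
    field
      facilities : ℕ
      clients    : ℕ
      enough     : suc k ℕ.≤ facilities

    Facility : Set
    Facility = Fin facilities

    Client : Set
    Client = Fin clients

    Point : Set
    Point = Facility ⊎ Client

    field
      openingCost         : Facility → Carrier
      openingCost-nonNeg  : ∀ i → 0# ≤ openingCost i
      dist                : Point → Point → Carrier
      dist-isPreMetric    : IsPreMetric _≡_ _≈_ _≤_ 0# dist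
      dist-symmetric      : Metric.Symmetric _≈_ dist
      dist-triangle       : Metric.TriangleInequality _≤_ _+_ dist

    connectionCost : Facility → Client → Carrier
    connectionCost i j = dist (inj₁ i) (inj₂ j)

    -- The facilities the adversary closes.
    Scenario : Set
    Scenario = Σ (Subset facilities) λ A → ∣ A ∣ ≡ k

  module _ {k : ℕ} (I : Instance k) where
    open Instance I

    record FractionalSolution : Set (c ⊔ ℓ₁ ⊔ ℓ₂) where
      field
        y        : Facility → Carrier
        x        : Scenario → Facility → Client → Carrier
        covered  : ∀ A j → 1# ≤ sum (λ i → x A i j)
        opened   : ∀ A i j → x A i j ≤ y i
        closed   : ∀ A i j → i ∈ proj₁ A → x A i j ≈ 0#
        x-nonNeg : ∀ A i j → 0# ≤ x A i j
        y-nonNeg : ∀ i → 0# ≤ y i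

    open FractionalSolution

    IsIntegral : FractionalSolution → Set ℓ₁
    IsIntegral s = (∀ i → IsInteger (y s i)) × (∀ A i j → IsInteger (x s A i j))

    scenarioCost : FractionalSolution → Scenario → Carrier
    scenarioCost s A = sum λ j → sum λ i → connectionCost i j * x s A i j

    IsWorstCaseCost : FractionalSolution → Carrier → Set (c ⊔ ℓ₁ ⊔ ℓ₂)
    IsWorstCaseCost s = IsGreatest λ w → ∃ λ A → w ≈ scenarioCost s A

    HasCost : FractionalSolution → Carrier → Set (c ⊔ ℓ₁ ⊔ ℓ₂)
    HasCost s v = ∃ λ w →
      IsWorstCaseCost s w × v ≈ sum (λ i → openingCost i * y s i) + w

    IsFractionalOptimum : Carrier → Set (c ⊔ ℓ₁ ⊔ ℓ₂)
    IsFractionalOptimum = IsLeast λ v → ∃ λ s → HasCost s v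

    IsIntegralOptimum : Carrier → Set (c ⊔ ℓ₁ ⊔ ℓ₂)
    IsIntegralOptimum = IsLeast λ v → ∃ λ s → IsIntegral s × HasCost s v

    -- g is the quotient of the two optima; it exists only when the fractional
    -- optimum is positive.
    IsIntegralityGap : Carrier → Set (c ⊔ ℓ₁ ⊔ ℓ₂)
    IsIntegralityGap g = ∃ λ int → ∃ λ frac →
      IsIntegralOptimum int × IsFractionalOptimum frac ×
      0# < frac × g * frac ≈ int

{-# OPTIONS --safe #-}

-- Put n = k + m facilities of opening cost 1 and a single client at one point.
-- All connection costs vanish, so a solution costs the sum of its y, and the
-- LP only asks that the facilities outside every k-set A have y-weight at
-- least 1.  Integrally k + 1 facilities are needed and suffice.  Fractionally
-- y = 1/m is feasible, and averaging over all A shows that no solution costs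
-- less than n/m.  The gap (k + 1) m / (k + m) tends to k + 1 as m grows.

module Submission where

open import Defs
open import Data.Nat as ℕ using (ℕ; suc)
open import Data.Product using (∃; _×_; _,_; proj₁; proj₂)
import Algebra.Properties.Monoid.Mult as Mult
import Algebra.Properties.Ring as RingProperties
import Algebra.Solver.Ring.NaturalCoefficients.Default as SemiringSolver
open import Data.Bool.Base using (true; false; if_then_else_)
open import Data.Empty using (⊥-elim)
open import Data.Fin using (Fin; zero; suc)
open import Data.Fin.Subset using (Subset; inside; outside; ∣_∣; ⊤; ⊥)
open import Data.Fin.Subset.Properties using (∣⊤∣≡n; ∣⊥∣≡0)
open import Data.Integer using (+_; -[1+_])
open import Data.Nat.Base using (z≤n; s≤s)
import Data.Nat.Properties as ℕ
open import Data.Sum using (_⊎_; inj₁; inj₂)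
open import Data.Vec using ([]; _∷_; lookup)
open import Data.Vec.Properties using ([]=⇒lookup; lookup⇒[]=)
open import Function using (_∘_)
open import Relation.Binary.Bundles using (Poset)
import Relation.Binary.Reasoning.PartialOrder as PosetReasoning
open import Relation.Binary.PropositionalEquality as ≡ using (_≡_)
open import Relation.Binary.Structures using (IsTotalOrder)
open import Relation.Nullary using (¬_; contradiction)

subset-of-size : ∀ {k n} → k ℕ.≤ n → ∃ λ (A : Subset n) → ∣ A ∣ ≡ k
subset-of-size {n = n} z≤n = ⊥ , ∣⊥∣≡0 n
subset-of-size (s≤s k≤n) with A , ∣A∣≡k ← subset-of-size k≤n =
  inside ∷ A , ≡.cong suc ∣A∣≡k

module _ {c ℓ₁ ℓ₂} (K : ArchimedeanOrderedField c ℓ₁ ℓ₂) where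
  open ArchimedeanOrderedField K hiding (zero)
  open IsTotalOrder isTotalOrder using (total; antisym; isPartialOrder)
    renaming (refl to ≤-refl; reflexive to ≤-reflexive; trans to ≤-trans)
  open Mult +-monoid using (×-homo-+; ×-congˡ)
  open RingProperties ring using (-‿distribʳ-*; -‿involutive)
  open SemiringSolver commutativeSemiring using (solve; _:+_; _:*_; _:=_)

  poset : Poset c ℓ₁ ℓ₂
  poset = record { isPartialOrder = isPartialOrder }

  open PosetReasoning poset

  -- Ordered fields

  +-monoʳ-≤ : ∀ z {x y} → x ≤ y → z + x ≤ z + y
  +-monoʳ-≤ z {x} {y} x≤y = begin
    z + x  ≈⟨ +-comm z x ⟩
    x + z  ≤⟨ +-monoˡ-≤ z x≤y ⟩
    y + z  ≈⟨ +-comm y z ⟩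
    z + y  ∎

  +-mono-≤ : ∀ {x y u v} → x ≤ y → u ≤ v → x + u ≤ y + v
  +-mono-≤ {y = y} {u} x≤y u≤v = ≤-trans (+-monoˡ-≤ u x≤y) (+-monoʳ-≤ y u≤v)

  -x+[x+y]≈y : ∀ x y → - x + (x + y) ≈ y
  -x+[x+y]≈y x y = begin-equality
    - x + (x + y)  ≈⟨ +-assoc (- x) x y ⟨
    - x + x + y    ≈⟨ +-congʳ (-‿inverseˡ x) ⟩
    0# + y         ≈⟨ +-identityˡ y ⟩
    y              ∎

  +-cancelˡ-≤ : ∀ z {x y} → z + x ≤ z + y → x ≤ y
  +-cancelˡ-≤ z {x} {y} z+x≤z+y = begin
    x              ≈⟨ -x+[x+y]≈y z x ⟨
    - z + (z + x)  ≤⟨ +-monoʳ-≤ (- z) z+x≤z+y ⟩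
    - z + (z + y)  ≈⟨ -x+[x+y]≈y z y ⟩
    y              ∎

  x≤y⇒0≤y-x : ∀ {x y} → x ≤ y → 0# ≤ y - x
  x≤y⇒0≤y-x {x} {y} x≤y = begin
    0#     ≈⟨ -‿inverseʳ x ⟨
    x - x  ≤⟨ +-monoˡ-≤ (- x) x≤y ⟩
    y - x  ∎

  y+[x-y]≈x : ∀ x y → y + (x - y) ≈ x
  y+[x-y]≈x x y = begin-equality
    y + (x - y)    ≈⟨ +-congˡ (+-comm x (- y)) ⟩
    y + (- y + x)  ≈⟨ +-assoc y (- y) x ⟨
    y - y + x      ≈⟨ +-congʳ (-‿inverseʳ y) ⟩
    0# + x         ≈⟨ +-identityˡ x ⟩
    x              ∎

  *-monoʳ-≤ : ∀ {z} → 0# ≤ z → ∀ {x y} → x ≤ y → z * x ≤ z * y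
  *-monoʳ-≤ {z} 0≤z {x} {y} x≤y = begin
    z * x                ≈⟨ +-identityʳ (z * x) ⟨
    z * x + 0#           ≤⟨ +-monoʳ-≤ (z * x) (*-nonNegative 0≤z (x≤y⇒0≤y-x x≤y)) ⟩
    z * x + z * (y - x)  ≈⟨ distribˡ z x (y - x) ⟨
    z * (x + (y - x))    ≈⟨ *-congˡ (y+[x-y]≈x y x) ⟩
    z * y                ∎

  0≤1 : 0# ≤ 1#
  0≤1 with total 0# 1#
  ... | inj₁ 0≤1 = 0≤1
  ... | inj₂ 1≤0 = begin
    0#             ≤⟨ *-nonNegative 0≤-1 0≤-1 ⟩
    - 1# * - 1#    ≈⟨ -‿distribʳ-* (- 1#) 1# ⟨
    - (- 1# * 1#)  ≈⟨ -‿cong (*-identityʳ (- 1#)) ⟩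
    - - 1#         ≈⟨ -‿involutive 1# ⟩
    1#             ∎
    where
    0≤-1 : 0# ≤ - 1#
    0≤-1 = ≤-trans (x≤y⇒0≤y-x 1≤0) (≤-reflexive (+-identityˡ _))

  1≰0 : ¬ (1# ≤ 0#)
  1≰0 1≤0 = 0≉1 (antisym 0≤1 1≤0)

  fromℕ-nonNeg : ∀ n → 0# ≤ fromℕ n
  fromℕ-nonNeg ℕ.zero  = ≤-refl
  fromℕ-nonNeg (suc n) =
    ≤-trans (≤-reflexive (sym (+-identityˡ 0#))) (+-mono-≤ 0≤1 (fromℕ-nonNeg n))

  1≤fromℕ-suc : ∀ n → 1# ≤ fromℕ (suc n)
  1≤fromℕ-suc n =
    ≤-trans (≤-reflexive (sym (+-identityʳ 1#))) (+-monoʳ-≤ 1# (fromℕ-nonNeg n))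

  fromℕ-suc≉0 : ∀ n → ¬ (fromℕ (suc n) ≈ 0#)
  fromℕ-suc≉0 n sn≈0 = 1≰0 (≤-trans (1≤fromℕ-suc n) (≤-reflexive sn≈0))

  inverse-nonNeg : ∀ {x y} → 0# ≤ x → x * y ≈ 1# → 0# ≤ y
  inverse-nonNeg {x} {y} 0≤x xy≈1 with total 0# y
  ... | inj₁ 0≤y = 0≤y
  ... | inj₂ y≤0 = ⊥-elim (1≰0 (begin
    1#      ≈⟨ xy≈1 ⟨
    x * y   ≤⟨ *-monoʳ-≤ 0≤x y≤0 ⟩
    x * 0#  ≈⟨ zeroʳ x ⟩
    0#      ∎))

  *-cancelˡ-≤ : ∀ {z} → 0# ≤ z → ¬ (z ≈ 0#) → ∀ {x y} → z * x ≤ z * y → x ≤ y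
  *-cancelˡ-≤ {z} 0≤z z≉0 {x} {y} zx≤zy with w , zw≈1 ← inverse z z≉0 = begin
    x            ≈⟨ w[zt]≈t x ⟨
    w * (z * x)  ≤⟨ *-monoʳ-≤ (inverse-nonNeg 0≤z zw≈1) zx≤zy ⟩
    w * (z * y)  ≈⟨ w[zt]≈t y ⟩
    y            ∎
    where
    w[zt]≈t : ∀ t → w * (z * t) ≈ t
    w[zt]≈t t = begin-equality
      w * (z * t)  ≈⟨ *-assoc w z t ⟨
      w * z * t    ≈⟨ *-congʳ (trans (*-comm w z) zw≈1) ⟩
      1# * t       ≈⟨ *-identityˡ t ⟩
      t            ∎

  integer-nonNeg : ∀ {x} → IsInteger x → 0# ≤ x → x ≈ 0# ⊎ 1# ≤ x
  integer-nonNeg (+ ℕ.zero , x≈0) 0≤x = inj₁ x≈0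
  integer-nonNeg (+ suc n , x≈sn) 0≤x =
    inj₂ (≤-trans (1≤fromℕ-suc n) (≤-reflexive (sym x≈sn)))
  integer-nonNeg {x} (-[1+ n ] , x≈-sn) 0≤x = ⊥-elim (1≰0 (begin
    1#                               ≤⟨ 1≤fromℕ-suc n ⟩
    fromℕ (suc n)                    ≈⟨ +-identityʳ _ ⟨
    fromℕ (suc n) + 0#               ≤⟨ +-monoʳ-≤ _ 0≤x ⟩
    fromℕ (suc n) + x                ≈⟨ +-congˡ x≈-sn ⟩
    fromℕ (suc n) - fromℕ (suc n)    ≈⟨ -‿inverseʳ _ ⟩
    0#                               ∎))

  -- Sums over the complement of a subset

  sum-mono-≤ : ∀ {n} {f g : Fin n → Carrier} → (∀ i → f i ≤ g i) → sum f ≤ sum g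
  sum-mono-≤ {ℕ.zero} f≤g = ≤-refl
  sum-mono-≤ {suc n}  f≤g = +-mono-≤ (f≤g zero) (sum-mono-≤ (f≤g ∘ suc))

  sum-cong : ∀ {n} {f g : Fin n → Carrier} → (∀ i → f i ≈ g i) → sum f ≈ sum g
  sum-cong {ℕ.zero} f≈g = refl
  sum-cong {suc n}  f≈g = +-cong (f≈g zero) (sum-cong (f≈g ∘ suc))

  sum-zero : ∀ {n} {f : Fin n → Carrier} → (∀ i → f i ≈ 0#) → sum f ≈ 0#
  sum-zero {ℕ.zero} f≈0 = refl
  sum-zero {suc n}  f≈0 =
    trans (+-cong (f≈0 zero) (sum-zero (f≈0 ∘ suc))) (+-identityˡ 0#)

  sum-const : ∀ n u → sum {n} (λ _ → u) ≈ fromℕ n * u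
  sum-const ℕ.zero  u = sym (zeroˡ u)
  sum-const (suc n) u = begin-equality
    u + sum {n} (λ _ → u)  ≈⟨ +-cong (sym (*-identityˡ u)) (sum-const n u) ⟩
    1# * u + fromℕ n * u   ≈⟨ distribʳ u 1# _ ⟨
    (1# + fromℕ n) * u     ∎

  avoid : ∀ {n} → Subset n → (Fin n → Carrier) → Fin n → Carrier
  avoid A y i = if lookup A i then 0# else y i

  avoid-inside : ∀ {n} (A : Subset n) y {i} → lookup A i ≡ inside → avoid A y i ≡ 0#
  avoid-inside A y eq rewrite eq = ≡.refl

  avoid-≤ : ∀ {n} (A : Subset n) {y} → (∀ i → 0# ≤ y i) → ∀ i → avoid A y i ≤ y i
  avoid-≤ A 0≤y i with lookup A i
  ... | true  = 0≤y i
  ... | false = ≤-refl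

  avoid-nonNeg : ∀ {n} (A : Subset n) {y} → (∀ i → 0# ≤ y i) → ∀ i → 0# ≤ avoid A y i
  avoid-nonNeg A 0≤y i with lookup A i
  ... | true  = ≤-refl
  ... | false = 0≤y i

  sum-avoid-⊥ : ∀ {n} (y : Fin n → Carrier) → sum (avoid ⊥ y) ≡ sum y
  sum-avoid-⊥ {ℕ.zero} y = ≡.refl
  sum-avoid-⊥ {suc n}  y = ≡.cong (λ s → y zero + s) (sum-avoid-⊥ (y ∘ suc))

  sum-avoid-⊤ : ∀ {n} (y : Fin n → Carrier) → sum (avoid ⊤ y) ≈ 0#
  sum-avoid-⊤ {ℕ.zero} y = refl
  sum-avoid-⊤ {suc n}  y = trans (+-identityˡ _) (sum-avoid-⊤ (y ∘ suc))

  sum-≤-avoid : ∀ {n} (A : Subset n) {u} {y : Fin n → Carrier} → (∀ i → y i ≤ u) →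
                sum y ≤ fromℕ ∣ A ∣ * u + sum (avoid A y)
  sum-≤-avoid [] {u} y≤u =
    ≤-reflexive (sym (trans (+-identityʳ _) (zeroˡ u)))
  sum-≤-avoid (true ∷ A) {u} {y} y≤u = begin
    y zero + sum (y ∘ suc)
      ≤⟨ +-mono-≤ (y≤u zero) (sum-≤-avoid A (y≤u ∘ suc)) ⟩
    u + (a * u + s)
      ≈⟨ +-cong (*-identityˡ u) (+-congˡ (+-identityˡ s)) ⟨
    1# * u + (a * u + (0# + s))
      ≈⟨ +-assoc _ _ _ ⟨
    1# * u + a * u + (0# + s)
      ≈⟨ +-congʳ (distribʳ u 1# a) ⟨
    (1# + a) * u + (0# + s)  ∎
    where
    a = fromℕ ∣ A ∣
    s = sum (avoid A (y ∘ suc))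
  sum-≤-avoid (false ∷ A) {u} {y} y≤u = begin
    y zero + sum (y ∘ suc)
      ≤⟨ +-monoʳ-≤ _ (sum-≤-avoid A (y≤u ∘ suc)) ⟩
    y zero + (fromℕ ∣ A ∣ * u + s)
      ≈⟨ solve 3 (λ p q r → p :+ (q :+ r) := q :+ (p :+ r)) refl (y zero) _ s ⟩
    fromℕ ∣ A ∣ * u + (y zero + s)  ∎
    where
    s = sum (avoid A (y ∘ suc))

  indicator : ∀ {n} → Subset n → Fin n → Carrier
  indicator B i = if lookup B i then 1# else 0#

  sum-indicator : ∀ {n} (B : Subset n) → sum (indicator B) ≈ fromℕ ∣ B ∣
  sum-indicator []          = refl
  sum-indicator (true ∷ B)  = +-congˡ (sum-indicator B)
  sum-indicator (false ∷ B) = trans (+-identityˡ _) (sum-indicator B)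

  indicator-nonNeg : ∀ {n} (B : Subset n) i → 0# ≤ indicator B i
  indicator-nonNeg B i with lookup B i
  ... | true  = 0≤1
  ... | false = ≤-refl

  indicator-≤1 : ∀ {n} (B : Subset n) i → indicator B i ≤ 1#
  indicator-≤1 B i with lookup B i
  ... | true  = ≤-refl
  ... | false = 0≤1

  IsInteger-0 : IsInteger 0#
  IsInteger-0 = + 0 , refl

  indicator-integer : ∀ {n} (B : Subset n) i → IsInteger (indicator B i)
  indicator-integer B i with lookup B i
  ... | true  = + 1 , sym (+-identityʳ 1#)
  ... | false = IsInteger-0

  avoid-integer : ∀ {n} (A : Subset n) {y} → (∀ i → IsInteger (y i)) →
                  ∀ i → IsInteger (avoid A y i)
  avoid-integer A int i with lookup A i
  ... | true  = IsInteger-0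
  ... | false = int i

  -- Lower bounds for fractional and integral solutions

  -- K₁ times the first bound plus M times the second, both divided by N.
  averaging-step : ∀ {M K K₁ N N₁ b c t S} →
    0# ≤ M → 0# ≤ K₁ → 0# ≤ N → ¬ (N ≈ 0#) → N ≈ K + M → N₁ ≈ K₁ + M →
    N * c + K * S ≤ N * (b + S) →
    N * c + K₁ * S ≤ N * ((b + t) + S) →
    N₁ * c + K₁ * (t + S) ≤ N₁ * (b + (t + S))
  averaging-step {M} {K} {K₁} {N} {N₁} {b} {c} {t} {S} 0≤M 0≤K₁ 0≤N N≉0 N≈ N₁≈ ih₁ ih₂ =
    *-cancelˡ-≤ 0≤N N≉0 (begin
      N * (N₁ * c + K₁ * (t + S))
        ≈⟨ *-congˡ (+-congʳ (*-congʳ N₁≈)) ⟩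
      N * ((K₁ + M) * c + K₁ * (t + S))
        ≈⟨ solve 6 (λ n k m c t s →
             n :* ((k :+ m) :* c :+ k :* (t :+ s)) :=
             n :* ((k :+ m) :* c :+ k :* t) :+ (k :* s) :* n) refl N K₁ M c t S ⟩
      N * ((K₁ + M) * c + K₁ * t) + K₁ * S * N
        ≈⟨ +-congˡ (*-congˡ N≈) ⟩
      N * ((K₁ + M) * c + K₁ * t) + K₁ * S * (K + M)
        ≈⟨ solve 7 (λ n k k₁ m c t s →
             n :* ((k₁ :+ m) :* c :+ k₁ :* t) :+ k₁ :* s :* (k :+ m) :=
             k₁ :* (n :* c :+ k :* s) :+ m :* (n :* c :+ k₁ :* s) :+ k₁ :* n :* t)
             refl N K K₁ M c t S ⟩
      K₁ * (N * c + K * S) + M * (N * c + K₁ * S) + K₁ * N * t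
        ≤⟨ +-monoˡ-≤ _ (+-mono-≤ (*-monoʳ-≤ 0≤K₁ ih₁) (*-monoʳ-≤ 0≤M ih₂)) ⟩
      K₁ * (N * (b + S)) + M * (N * ((b + t) + S)) + K₁ * N * t
        ≈⟨ solve 6 (λ n k m b t s →
             k :* (n :* (b :+ s)) :+ m :* (n :* ((b :+ t) :+ s)) :+ k :* n :* t :=
             n :* ((k :+ m) :* (b :+ (t :+ s)))) refl N K₁ M b t S ⟩
      N * ((K₁ + M) * (b + (t + S)))
        ≈⟨ *-congˡ (*-congʳ N₁≈) ⟨
      N * (N₁ * (b + (t + S)))  ∎)

  -- The average of sum (avoid A y) over the k-subsets A is (n - k)/n * sum y;
  -- the conclusion is c ≤ b + average, multiplied by n and with k * sum y moved
  -- to the left.  The offset b absorbs y zero in the induction on n.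
  averaging : ∀ {n k} → k ℕ.≤ n → ∀ {b c} (y : Fin n → Carrier) →
              (∀ A → ∣ A ∣ ≡ k → c ≤ b + sum (avoid A y)) →
              fromℕ n * c + fromℕ k * sum y ≤ fromℕ n * (b + sum y)
  averaging {n} z≤n {b} {c} y h = begin
    fromℕ n * c + 0# * sum y  ≈⟨ +-congˡ (zeroˡ _) ⟩
    fromℕ n * c + 0#          ≈⟨ +-identityʳ _ ⟩
    fromℕ n * c               ≤⟨ *-monoʳ-≤ (fromℕ-nonNeg n) (h ⊥ (∣⊥∣≡0 n)) ⟩
    fromℕ n * (b + sum (avoid ⊥ y))
      ≡⟨ ≡.cong (λ s → fromℕ n * (b + s)) (sum-avoid-⊥ y) ⟩
    fromℕ n * (b + sum y)     ∎
  averaging {suc n} {suc k} (s≤s k≤n) {b} {c} y h with ℕ.m≤n⇒m<n∨m≡n k≤n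
  ... | inj₂ ≡.refl = begin
    N * c + N * sum y  ≈⟨ distribˡ N c (sum y) ⟨
    N * (c + sum y)    ≤⟨ *-monoʳ-≤ (fromℕ-nonNeg (suc n)) (+-monoˡ-≤ (sum y) c≤b) ⟩
    N * (b + sum y)    ∎
    where
    N = fromℕ (suc n)
    c≤b : c ≤ b
    c≤b = begin
      c                      ≤⟨ h ⊤ (∣⊤∣≡n (suc n)) ⟩
      b + sum (avoid ⊤ y)    ≈⟨ +-congˡ (sum-avoid-⊤ y) ⟩
      b + 0#                 ≈⟨ +-identityʳ b ⟩
      b                      ∎
  ... | inj₁ k<n@(s≤s {n = n-1} _) =
    averaging-step (fromℕ-nonNeg (n ℕ.∸ k)) (fromℕ-nonNeg (suc k))
      (fromℕ-nonNeg n) (fromℕ-suc≉0 n-1)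
      n≈k+m (trans (+-congˡ n≈k+m) (sym (+-assoc _ _ _)))
      (averaging k≤n (y ∘ suc) λ A ∣A∣≡k →
        ≤-trans (h (inside ∷ A) (≡.cong suc ∣A∣≡k))
                (≤-reflexive (+-congˡ (+-identityˡ _))))
      (averaging k<n (y ∘ suc) λ A ∣A∣≡k →
        ≤-trans (h (outside ∷ A) ∣A∣≡k) (≤-reflexive (sym (+-assoc _ _ _))))
    where
    n≈k+m : fromℕ n ≈ fromℕ k + fromℕ (n ℕ.∸ k)
    n≈k+m = trans (×-congˡ (≡.sym (ℕ.m+[n∸m]≡n k≤n))) (×-homo-+ 1# k (n ℕ.∸ k))

  integral-bound : ∀ {n k} → k ℕ.≤ n → (y : Fin n → Carrier) →
                   (∀ i → y i ≈ 0# ⊎ 1# ≤ y i) →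
                   (∀ A → ∣ A ∣ ≡ k → 1# ≤ sum (avoid A y)) →
                   fromℕ (suc k) ≤ sum y
  integral-bound {n} z≤n y int h = begin
    1# + 0#          ≈⟨ +-identityʳ 1# ⟩
    1#               ≤⟨ h ⊥ (∣⊥∣≡0 n) ⟩
    sum (avoid ⊥ y)  ≡⟨ sum-avoid-⊥ y ⟩
    sum y            ∎
  integral-bound {suc n} {suc k} (s≤s k≤n) y int h with int zero
  ... | inj₂ 1≤y₀ = +-mono-≤ 1≤y₀ (integral-bound k≤n (y ∘ suc) (int ∘ suc) λ A ∣A∣≡k →
    ≤-trans (h (inside ∷ A) (≡.cong suc ∣A∣≡k)) (≤-reflexive (+-identityˡ _)))
  ... | inj₁ y₀≈0 with ℕ.m≤n⇒m<n∨m≡n k≤n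
  ...   | inj₂ ≡.refl = contradiction
    (≤-trans (h ⊤ (∣⊤∣≡n (suc n))) (≤-reflexive (sum-avoid-⊤ y))) 1≰0
  ...   | inj₁ k<n =
    ≤-trans (integral-bound k<n (y ∘ suc) (int ∘ suc) λ A ∣A∣≡k →
              ≤-trans (h (outside ∷ A) ∣A∣≡k) (≤-reflexive (y₀+s≈s _)))
            (≤-reflexive (sym (y₀+s≈s _)))
    where
    y₀+s≈s : ∀ s → y zero + s ≈ s
    y₀+s≈s s = trans (+-congʳ y₀≈0) (+-identityˡ s)

  -- Co-located facilities

  colocated : ∀ {k} n → suc k ℕ.≤ n → Instance K k
  colocated n k<n = record
    { facilities         = n
    ; clients            = 1
    ; enough             = k<n
    ; openingCost        = λ _ → 1#
    ; openingCost-nonNeg = λ _ → 0≤1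
    ; dist               = λ _ _ → 0#
    ; dist-isPreMetric   = record
      { isProtoMetric = record
        { isPartialOrder  = isPartialOrder
        ; ≈-isEquivalence = ≡.isEquivalence
        ; cong            = λ _ _ → refl
        ; nonNegative     = ≤-refl
        }
      ; ≈⇒0 = λ _ → refl
      }
    ; dist-symmetric = λ _ _ → refl
    ; dist-triangle  = λ _ _ _ → ≤-reflexive (sym (+-identityˡ 0#))
    }

  module Colocated {k n} (k<n : suc k ℕ.≤ n) where
    I : Instance K k
    I = colocated n k<n

    open Instance I using (Scenario)
    open FractionalSolution

    Solution : Set _
    Solution = FractionalSolution K I

    k≤n : k ℕ.≤ n
    k≤n = ℕ.<⇒≤ k<n

    scenarioCost-zero : ∀ (s : Solution) A → scenarioCost K I s A ≈ 0#
    scenarioCost-zero s A = sum-zero {1} λ j → sum-zero {n} λ i → zeroˡ (x s A i j)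

    totalCost : ∀ (s : Solution) {w} → w ≈ 0# → sum (λ i → 1# * y s i) + w ≈ sum (y s)
    totalCost s w≈0 =
      trans (+-cong (sum-cong λ i → *-identityˡ (y s i)) w≈0) (+-identityʳ _)

    hasCost : ∀ (s : Solution) {v} → sum (y s) ≈ v → HasCost K I s v
    hasCost s eq =
      0# ,
      ( (subset-of-size k≤n , sym (scenarioCost-zero s _))
      , λ w (A , w≈) → ≤-reflexive (trans w≈ (scenarioCost-zero s A))) ,
      sym (trans (totalCost s refl) eq)

    cost≈sum : ∀ {s v} → HasCost K I s v → v ≈ sum (y s)
    cost≈sum {s} (w , ((A , w≈) , _) , v≈) =
      trans v≈ (totalCost s (trans w≈ (scenarioCost-zero s A)))

    outside-covered : ∀ (s : Solution) A → ∣ A ∣ ≡ k → 1# ≤ sum (avoid A (y s))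
    outside-covered s A ∣A∣≡k =
      ≤-trans (covered s (A , ∣A∣≡k) zero) (sum-mono-≤ x≤avoid)
      where
      x≤avoid : ∀ i → x s (A , ∣A∣≡k) i zero ≤ avoid A (y s) i
      x≤avoid i with lookup A i in eq
      ... | true  = ≤-reflexive (closed s (A , ∣A∣≡k) i zero (lookup⇒[]= i A eq))
      ... | false = opened s (A , ∣A∣≡k) i zero

    solution : ∀ (y : Fin n → Carrier) u → (∀ i → 0# ≤ y i) → (∀ i → y i ≤ u) →
               sum y ≈ fromℕ k * u + 1# → Solution
    solution y u 0≤y y≤u sum≈ = record
      { y        = y
      ; x        = λ (A , _) i _ → avoid A y i
      ; covered  = λ { (A , ≡.refl) _ → +-cancelˡ-≤ (fromℕ ∣ A ∣ * u)
                         (≤-trans (≤-reflexive (sym sum≈)) (sum-≤-avoid A y≤u)) }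
      ; opened   = λ (A , _) i _ → avoid-≤ A 0≤y i
      ; closed   = λ (A , _) i _ i∈A → reflexive (avoid-inside A y ([]=⇒lookup i∈A))
      ; x-nonNeg = λ (A , _) i _ → avoid-nonNeg A 0≤y i
      ; y-nonNeg = 0≤y
      }

    integral-optimum : IsIntegralOptimum K I (fromℕ (suc k))
    integral-optimum with B , ∣B∣≡1+k ← subset-of-size k<n =
      (s , ((indicator-integer B , λ (A , _) i _ → avoid-integer A (indicator-integer B) i)
         , hasCost s sum≈)) ,
      λ v (s , (y-int , _) , cost) → begin
        fromℕ (suc k)  ≤⟨ integral-bound k≤n (y s)
                            (λ i → integer-nonNeg (y-int i) (y-nonNeg s i))
                            (outside-covered s) ⟩
        sum (y s)      ≈⟨ cost≈sum {s} cost ⟨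
        v              ∎
      where
      sum≈ : sum (indicator B) ≈ fromℕ (suc k)
      sum≈ = trans (sum-indicator B) (×-congˡ ∣B∣≡1+k)
      s : Solution
      s = solution (indicator B) 1# (indicator-nonNeg B) (indicator-≤1 B) (begin-equality
        sum (indicator B)  ≈⟨ sum≈ ⟩
        1# + fromℕ k       ≈⟨ +-comm 1# _ ⟩
        fromℕ k + 1#       ≈⟨ +-congʳ (*-identityʳ _) ⟨
        fromℕ k * 1# + 1#  ∎)

    fractional-optimum : ∀ {m u} → 0# ≤ m → m * u ≈ 1# → fromℕ n ≈ fromℕ k + m →
                         IsFractionalOptimum K I (fromℕ n * u)
    fractional-optimum {m} {u} 0≤m mu≈1 n≈k+m =
      (s , hasCost s sum≈) ,
      λ v (s , cost) → begin
        fromℕ n * u          ≈⟨ *-comm _ u ⟩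
        u * fromℕ n          ≤⟨ *-monoʳ-≤ 0≤u (n≤mS s) ⟩
        u * (m * sum (y s))  ≈⟨ *-assoc u m _ ⟨
        u * m * sum (y s)    ≈⟨ *-congʳ (trans (*-comm u m) mu≈1) ⟩
        1# * sum (y s)       ≈⟨ *-identityˡ _ ⟩
        sum (y s)            ≈⟨ cost≈sum {s} cost ⟨
        v                    ∎
      where
      0≤u : 0# ≤ u
      0≤u = inverse-nonNeg 0≤m mu≈1

      sum≈ : sum {n} (λ _ → u) ≈ fromℕ n * u
      sum≈ = sum-const n u

      s : Solution
      s = solution (λ _ → u) u (λ _ → 0≤u) (λ _ → ≤-refl) (begin-equality
        sum {n} (λ _ → u)    ≈⟨ sum≈ ⟩
        fromℕ n * u          ≈⟨ *-congʳ n≈k+m ⟩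
        (fromℕ k + m) * u    ≈⟨ distribʳ u _ m ⟩
        fromℕ k * u + m * u  ≈⟨ +-congˡ mu≈1 ⟩
        fromℕ k * u + 1#     ∎)

      n≤mS : ∀ (s : Solution) → fromℕ n ≤ m * sum (y s)
      n≤mS s = +-cancelˡ-≤ (fromℕ k * S) (begin
        fromℕ k * S + fromℕ n       ≈⟨ +-comm _ _ ⟩
        fromℕ n + fromℕ k * S       ≈⟨ +-congʳ (*-identityʳ _) ⟨
        fromℕ n * 1# + fromℕ k * S  ≤⟨ averaging k≤n (y s) (λ A ∣A∣≡k →
                                         ≤-trans (outside-covered s A ∣A∣≡k)
                                                 (≤-reflexive (sym (+-identityˡ _)))) ⟩
        fromℕ n * (0# + S)          ≈⟨ *-cong n≈k+m (+-identityˡ S) ⟩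
        (fromℕ k + m) * S           ≈⟨ distribʳ S _ m ⟩
        fromℕ k * S + m * S         ∎)
        where S = sum (y s)

  -- With δ = t - α, the claim is equivalent to t * k ≤ δ * (k + m).
  large-enough : ∀ {t α} k → 0# ≤ t → α < t →
                 ∃ λ m → (fromℕ k + fromℕ (suc m)) * α ≤ t * fromℕ (suc m)
  large-enough {t} {α} k 0≤t (α≤t , α≉t) = m , +-cancelˡ-≤ (t * fromℕ k) (begin
    t * fromℕ k + n * α         ≤⟨ +-monoˡ-≤ (n * α) tk≤δn ⟩
    δ * n + n * α               ≈⟨ solve 3 (λ d n a → d :* n :+ n :* a := (a :+ d) :* n) refl δ n α ⟩
    (α + δ) * n                 ≈⟨ *-congʳ (y+[x-y]≈x t α) ⟩
    t * n                       ≈⟨ distribˡ t _ _ ⟩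
    t * fromℕ k + t * fromℕ (suc m)  ∎)
    where
    δ = t - α
    0≤δ : 0# ≤ δ
    0≤δ = x≤y⇒0≤y-x α≤t
    δ≉0 : ¬ (δ ≈ 0#)
    δ≉0 δ≈0 = α≉t (begin-equality
      α        ≈⟨ +-identityʳ α ⟨
      α + 0#   ≈⟨ +-congˡ δ≈0 ⟨
      α + δ    ≈⟨ y+[x-y]≈x t α ⟩
      t        ∎)
    e = proj₁ (inverse δ δ≉0)
    m = proj₁ (archimedean (e * (t * fromℕ k)))
    n = fromℕ k + fromℕ (suc m)
    m≤n : fromℕ m ≤ n
    m≤n = begin
      fromℕ m               ≈⟨ trans (+-identityˡ _) (+-identityˡ _) ⟨
      0# + (0# + fromℕ m)   ≤⟨ +-mono-≤ (fromℕ-nonNeg k) (+-monoˡ-≤ _ 0≤1) ⟩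
      n                     ∎
    tk≤δn : t * fromℕ k ≤ δ * n
    tk≤δn = begin
      t * fromℕ k              ≈⟨ *-identityˡ _ ⟨
      1# * (t * fromℕ k)       ≈⟨ *-congʳ (proj₂ (inverse δ δ≉0)) ⟨
      δ * e * (t * fromℕ k)    ≈⟨ *-assoc δ e _ ⟩
      δ * (e * (t * fromℕ k))  ≤⟨ *-monoʳ-≤ 0≤δ (≤-trans (proj₂ (archimedean _)) m≤n) ⟩
      δ * n                    ∎

  integrality-gap : ∀ k α → α < fromℕ (suc k) →
                    ∃ λ (I : Instance K k) → ∃ λ g → IsIntegralityGap K I g × α ≤ g
  integrality-gap k α α<1+k
    with p , bound ← large-enough k (fromℕ-nonNeg (suc k)) α<1+k =
    I , g , (T , N * u , integral-optimum , fractional-optimum 0≤M Mu≈1 N≈k+M ,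
             (*-nonNegative 0≤N (inverse-nonNeg 0≤M Mu≈1) , 0≉Nu) , g*Nu≈T) ,
    *-cancelˡ-≤ 0≤N N≉0 (begin
      N * α              ≈⟨ *-congʳ N≈k+M ⟩
      (fromℕ k + M) * α  ≤⟨ bound ⟩
      T * M              ≈⟨ *-identityʳ _ ⟨
      T * M * 1#         ≈⟨ *-congˡ Nv≈1 ⟨
      T * M * (N * v)    ≈⟨ solve 3 (λ a n v → a :* (n :* v) := n :* (a :* v)) refl (T * M) N v ⟩
      N * g              ∎)
    where
    open Colocated (s≤s (ℕ.m≤m+n k p))
    T = fromℕ (suc k)
    M = fromℕ (suc p)
    N = fromℕ (suc (k ℕ.+ p))
    0≤M = fromℕ-nonNeg (suc p)
    0≤N = fromℕ-nonNeg (suc (k ℕ.+ p))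
    N≉0 = fromℕ-suc≉0 (k ℕ.+ p)
    u = proj₁ (inverse M (fromℕ-suc≉0 p))
    Mu≈1 = proj₂ (inverse M (fromℕ-suc≉0 p))
    v = proj₁ (inverse N N≉0)
    Nv≈1 = proj₂ (inverse N N≉0)
    g = T * M * v
    N≈k+M : N ≈ fromℕ k + M
    N≈k+M = trans (×-congˡ (≡.sym (ℕ.+-suc k p))) (×-homo-+ 1# k (suc p))
    0≉Nu : ¬ (0# ≈ N * u)
    0≉Nu 0≈Nu = N≉0 (begin-equality
      N            ≈⟨ *-identityʳ N ⟨
      N * 1#       ≈⟨ *-congˡ Mu≈1 ⟨
      N * (M * u)  ≈⟨ solve 3 (λ n m u → n :* (m :* u) := m :* (n :* u)) refl N M u ⟩
      M * (N * u)  ≈⟨ *-congˡ 0≈Nu ⟨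
      M * 0#       ≈⟨ zeroʳ M ⟩
      0#           ∎)
    g*Nu≈T : g * (N * u) ≈ T
    g*Nu≈T = begin-equality
      T * M * v * (N * u)
        ≈⟨ solve 5 (λ t m v n u → t :* m :* v :* (n :* u) := t :* (m :* u) :* (n :* v))
             refl T M v N u ⟩
      T * (M * u) * (N * v)  ≈⟨ *-cong (*-congˡ Mu≈1) Nv≈1 ⟩
      T * 1# * 1#            ≈⟨ *-identityʳ _ ⟩
      T * 1#                 ≈⟨ *-identityʳ T ⟩
      T                      ∎

mainTheorem7 : ∀ {c ℓ₁ ℓ₂} (K : ArchimedeanOrderedField c ℓ₁ ℓ₂) →
    let open ArchimedeanOrderedField K in
    (k : ℕ) → 1 ℕ.≤ k →
    (α : Carrier) → α < fromℕ (suc k) →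
    ∃ λ (I : Instance K k) → ∃ λ g → IsIntegralityGap K I g × α ≤ g
mainTheorem7 K k _ = integrality-gap K k
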